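{- Let $X$ be a finite set of cardinality $n$ and let $N=\binom{n}{2}$. The number of two-value magmas on $X$ that are idempotent elements of $\mathcal{M}(X)$ is exactly $$\sum_{m=0}^N\binom{N}{m}2^{N-m}=3^N.$$
   Context: $\mathcal{M}(X)=X^{X\times X}$ is the set of all binary operations on $X$, a monoid under $\triangleright$ defined by $a(\circ\triangleright\ast)b=(a\circ b)\ast(b\circ a)$ for all $a,b\in X$. An element $\ast\in\mathcal{M}(X)$ is idempotent if $\ast\triangleright\ast=\ast$. A binary operation $\ast\in\mathcal{M}(X)$ is called a two-value magma (two-valued magma) if $x\ast y\in\{x,y\}$ for all $x,y\in X$. -}

module Defs where

open import Algebra.Core using (Op₂)
import Algebra.Definitions as AlgebraDefinitions
open import Data.Fin.Base using (Fin)
open import Data.Nat.Base using (ℕ)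
open import Data.Product.Base using (_×_; proj₁)
open import Function.Bundles using (Inverse)
open import Level using (Level)
open import Relation.Binary.Bundles using (Setoid)
import Relation.Binary.Construct.On as On
open import Relation.Binary.PropositionalEquality
  using (_≡_; refl; sym; trans; setoid)

private
  variable
    a ℓ : Level

HasCardinality : Setoid a ℓ → ℕ → Set _
HasCardinality S n = Inverse S (setoid (Fin n))

-- Without function extensionality, equality of binary operations has to be
-- pointwise equality.
𝓜 : Set a → Setoid a a
𝓜 X = record
  { Carrier       = Op₂ X
  ; _≈_           = λ _∘_ _*_ → ∀ x y → x ∘ y ≡ x * y
  ; isEquivalence = record
    { refl  = λ x y → refl
    ; sym   = λ p x y → sym (p x y)
    ; trans = λ p q x y → trans (p x y) (q x y)
    }
  }

infixl 7 _▷_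

_▷_ : {X : Set a} → Op₂ (Op₂ X)
(_∘_ ▷ _*_) x y = (x ∘ y) * (y ∘ x)

IsIdempotent : {X : Set a} → Op₂ X → Set a
IsIdempotent {X = X} _*_ = _▷_ IdempotentOn _*_
  where open AlgebraDefinitions (Setoid._≈_ (𝓜 X)) using (_IdempotentOn_)

IsTwoValue : {X : Set a} → Op₂ X → Set a
IsTwoValue {X = X} = Selective
  where open AlgebraDefinitions (_≡_ {A = X}) using (Selective)

-- Elements are compared by their operation only: the accompanying proofs of
-- the two properties do not contribute to the count.
idempotentTwoValueMagmas : Set a → Setoid a a
idempotentTwoValueMagmas X =
  On.setoid (𝓜 X) (proj₁ {A = Op₂ X} {B = λ * → IsTwoValue * × IsIdempotent *})

{-# OPTIONS --safe #-}
-- For a two-value magma, idempotency fails at (x , y) exactly when x ≢ y,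
-- x * y ≡ y and y * x ≡ x.  So each of the N unordered pairs {x , y} leaves
-- three of the four values of (x * y , y * x), independently of one another.
-- Adding one point to a set of n points adds n pairs, whence a factor 3 ^ n.
module Submission where

open import Defs
open import Data.Nat.Properties using (+-*-semiring)
open import Algebra.Properties.Semiring.Sum +-*-semiring using (sum⁺-syntax)
open import Data.Fin.Base using (toℕ)
open import Data.Nat.Base using (ℕ; _*_; _∸_; _^_)
open import Data.Nat.Combinatorics using (_C_)
open import Data.Product.Base using (_×_)
open import Relation.Binary.PropositionalEquality using (_≡_; setoid)

open import Algebra.Bundles using (module Semiring)
open import Algebra.Core using (Op₂)
import Algebra.Definitions.RawSemiring as RawSemiring
import Algebra.Properties.CommutativeSemiring.Binomial as Binomial
open import Algebra.Properties.Semiring.Sum +-*-semiring using (sum-cong-≗)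
open import Data.Empty using (⊥; ⊥-elim)
open import Data.Fin.Base using (Fin; zero; suc; finToFun; funToFin; combine)
open import Data.Fin.Patterns using (0F; 1F; 2F)
open import Data.Fin.Properties
  using (*↔×; 0≢1+n; suc-injective; funToFin-finToFin; finToFun-funToFin)
open import Data.Nat.Base using (_+_; zero; suc)
open import Data.Nat.Combinatorics using (nC1≡n; nCk+nC[k+1]≡[n+1]C[k+1])
open import Data.Nat.Properties
  using (+-*-commutativeSemiring; *-identityˡ; ^-zeroˡ; ^-distribˡ-+-*)
open import Data.Product.Base using (_,_)
open import Data.Product.Function.NonDependent.Setoid using (_×-inverse_)
open import Data.Product.Relation.Binary.Pointwise.NonDependent
  using (_×ₛ_; Pointwise-≡↔≡)
open import Data.Sum.Base as Sum using (inj₁; inj₂)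
open import Function.Base using (_∘_)
open import Function.Bundles using (Inverse)
import Function.Properties.Inverse as Inv
open import Level using (Level)
open import Relation.Binary.Bundles using (Setoid)
open import Relation.Binary.PropositionalEquality
  using (refl; sym; trans; cong; cong₂; subst; _≗_; _→-setoid_; module ≡-Reasoning)

private
  module R = RawSemiring (Semiring.rawSemiring +-*-semiring)

  variable
    a b : Level
    X : Set a
    Y : Set b
    m n : ℕ

-- The sum as a binomial expansion

×≡* : ∀ m n → m R.× n ≡ m * n
×≡* zero    n = refl
×≡* (suc m) n = cong (n +_) (×≡* m n)

^≡^ : ∀ m n → m R.^ n ≡ m ^ n
^≡^ m zero    = refl
^≡^ m (suc n) = cong (m *_) (^≡^ m n)

-- The binomial theorem for `1 + 2`, which computes to `3`. It is phrased with the iterated sums and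
-- products of a general semiring, hence the conversions by `×≡*` and `^≡^`.
∑C*2^≡3^ : ∀ n → ∑[ m ≤ n ] ((n C toℕ m) * 2 ^ (n ∸ toℕ m)) ≡ 3 ^ n
∑C*2^≡3^ n = begin
  ∑[ m ≤ n ] ((n C toℕ m) * 2 ^ (n ∸ toℕ m)) ≡⟨ sum-cong-≗ {suc n} (sym ∘ term) ⟩
  binomialExpansion 1 2 n                    ≡⟨ theorem n 1 2 ⟨
  3 R.^ n                                    ≡⟨ ^≡^ 3 n ⟩
  3 ^ n                                      ∎
  where
  open ≡-Reasoning
  open Binomial +-*-commutativeSemiring
  term : ∀ m → binomialTerm 1 2 n m ≡ (n C toℕ m) * 2 ^ (n ∸ toℕ m)
  term m = begin
    (n C k) R.× (1 R.^ k * 2 R.^ (n ∸ k)) ≡⟨ ×≡* (n C k) _ ⟩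
    (n C k) * (1 R.^ k * 2 R.^ (n ∸ k))   ≡⟨ cong₂ (λ u v → (n C k) * (u * v)) (^≡^ 1 k) (^≡^ 2 (n ∸ k)) ⟩
    (n C k) * (1 ^ k * 2 ^ (n ∸ k))       ≡⟨ cong (λ u → (n C k) * (u * 2 ^ (n ∸ k))) (^-zeroˡ k) ⟩
    (n C k) * (1 * 2 ^ (n ∸ k))           ≡⟨ cong ((n C k) *_) (*-identityˡ _) ⟩
    (n C k) * 2 ^ (n ∸ k)                 ∎
    where k = toℕ m

-- Transport along a bijection

conjugate : (X → Y) → (Y → X) → Op₂ X → Op₂ Y
conjugate f g _*_ x y = f (g x * g y)

conjugate-cong : (f : X → Y) (g : Y → X) {_∘_ _*_ : Op₂ X} →
  (∀ x y → x ∘ y ≡ x * y) → ∀ x y → conjugate f g _∘_ x y ≡ conjugate f g _*_ x y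
conjugate-cong f g p x y = cong f (p (g x) (g y))

conjugate-inverse : (f : X → Y) (g : Y → X) → (∀ y → f (g y) ≡ y) → (_*_ : Op₂ Y) →
  ∀ x y → conjugate f g (conjugate g f _*_) x y ≡ x * y
conjugate-inverse f g fg _*_ x y = trans (fg _) (cong₂ _*_ (fg x) (fg y))

conjugate-isTwoValue : (f : X → Y) (g : Y → X) → (∀ y → f (g y) ≡ y) →
  {_*_ : Op₂ X} → IsTwoValue _*_ → IsTwoValue (conjugate f g _*_)
conjugate-isTwoValue f g fg tv x y =
  Sum.map (λ p → trans (cong f p) (fg x)) (λ p → trans (cong f p) (fg y)) (tv (g x) (g y))

-- In the iterated product each inner `f` meets an outer `g`, and the two cancel.
conjugate-isIdempotent : (f : X → Y) (g : Y → X) → (∀ x → g (f x) ≡ x) →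
  {_*_ : Op₂ X} → IsIdempotent _*_ → IsIdempotent (conjugate f g _*_)
conjugate-isIdempotent f g gf {_*_} idem x y =
  cong f (trans (cong₂ _*_ (gf _) (gf _)) (idem (g x) (g y)))

idempotentTwoValueMagmas-cong : Inverse (setoid X) (setoid Y) →
  Inverse (idempotentTwoValueMagmas X) (idempotentTwoValueMagmas Y)
idempotentTwoValueMagmas-cong I = record
  { to        = λ (_*_ , tv , idem) →
      conjugate to from _*_ , conjugate-isTwoValue to from strictlyInverseˡ tv
                            , conjugate-isIdempotent to from strictlyInverseʳ idem
  ; from      = λ (_*_ , tv , idem) →
      conjugate from to _*_ , conjugate-isTwoValue from to strictlyInverseʳ tv
                            , conjugate-isIdempotent from to strictlyInverseˡ idem
  ; to-cong   = conjugate-cong to from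
  ; from-cong = conjugate-cong from to
  ; inverse   =
      (λ {(_*_ , _)} p x y →
        trans (conjugate-cong to from p x y) (conjugate-inverse to from strictlyInverseˡ _*_ x y))
    , (λ {(_*_ , _)} p x y →
        trans (conjugate-cong from to p x y) (conjugate-inverse from to strictlyInverseʳ _*_ x y))
  }
  where open Inverse I

-- Splitting off one point

-- The pair (zero * suc j , suc j * zero) is coded by
--   0F ↦ (zero , zero),  1F ↦ (zero , suc j),  2F ↦ (suc j , suc j);
-- on the excluded pair (suc j , zero), encode returns the junk value 2F.
encode : Fin (suc n) → Fin (suc n) → Fin 3
encode zero    zero    = 0F
encode zero    (suc _) = 1F
encode (suc _) _       = 2F

decodeˡ decodeʳ : Fin 3 → Fin n → Fin (suc n)
decodeˡ 0F j = zero
decodeˡ 1F j = zero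
decodeˡ 2F j = suc j
decodeʳ 0F j = zero
decodeʳ 1F j = suc j
decodeʳ 2F j = suc j

encode-decode : ∀ c (j : Fin n) → encode (decodeˡ c j) (decodeʳ c j) ≡ c
encode-decode 0F j = refl
encode-decode 1F j = refl
encode-decode 2F j = refl

row : Op₂ (Fin (suc n)) → Fin n → Fin 3
row _*_ j = encode (zero * suc j) (suc j * zero)

predOr : Fin n → Fin (suc n) → Fin n
predOr i zero    = i
predOr i (suc j) = j

-- In a two-value magma suc i * suc j is never zero, so the default is not used.
restrict : Op₂ (Fin (suc n)) → Op₂ (Fin n)
restrict _*_ i j = predOr i (suc i * suc j)

extend : (Fin n → Fin 3) → Op₂ (Fin n) → Op₂ (Fin (suc n))
extend f _*_ zero    zero    = zero
extend f _*_ zero    (suc j) = decodeˡ (f j) j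
extend f _*_ (suc i) zero    = decodeʳ (f i) i
extend f _*_ (suc i) (suc j) = suc (i * j)

module _ {_*_ : Op₂ (Fin (suc n))} (tv : IsTwoValue _*_) where

  suc-restrict : ∀ i j → suc (restrict _*_ i j) ≡ suc i * suc j
  suc-restrict i j with suc i * suc j | tv (suc i) (suc j)
  ... | _ | inj₁ refl = refl
  ... | _ | inj₂ refl = refl

  restrict-isTwoValue : IsTwoValue (restrict _*_)
  restrict-isTwoValue i j =
    Sum.map (cong (predOr i)) (cong (predOr i)) (tv (suc i) (suc j))

  zero*zero : zero * zero ≡ zero
  zero*zero = Sum.reduce (tv zero zero)

  module _ (idem : IsIdempotent _*_) where

    -- By `suc-restrict`, `suc` embeds the restriction as a submagma, so the identity descends.
    restrict-isIdempotent : IsIdempotent (restrict _*_)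
    restrict-isIdempotent i j = suc-injective (begin
      suc (restrict _*_ (restrict _*_ i j) (restrict _*_ j i))
        ≡⟨ suc-restrict _ _ ⟩
      suc (restrict _*_ i j) * suc (restrict _*_ j i)
        ≡⟨ cong₂ _*_ (suc-restrict i j) (suc-restrict j i) ⟩
      (suc i * suc j) * (suc j * suc i)
        ≡⟨ idem (suc i) (suc j) ⟩
      suc i * suc j
        ≡⟨ suc-restrict i j ⟨
      suc (restrict _*_ i j) ∎)
      where open ≡-Reasoning

    -- On such a pair `_*_ ▷ _*_` multiplies in the reversed order and returns `zero` where `_*_`
    -- returns `suc j`.
    excluded : ∀ {j} → zero * suc j ≡ suc j → suc j * zero ≡ zero → ⊥
    excluded {j} p q = 0≢1+n (begin
      zero                              ≡⟨ q ⟨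
      suc j * zero                      ≡⟨ cong₂ _*_ p q ⟨
      (zero * suc j) * (suc j * zero)   ≡⟨ idem zero (suc j) ⟩
      zero * suc j                      ≡⟨ p ⟩
      suc j                             ∎)
      where open ≡-Reasoning

    decodeˡ-row : ∀ j → decodeˡ (row _*_ j) j ≡ zero * suc j
    decodeˡ-row j with zero * suc j | suc j * zero | tv zero (suc j)
    -- `encode` inspects its second argument only when the first is `zero`, so only then is
    -- `suc j * zero` split.
    ... | _ | zero  | inj₁ refl = refl
    ... | _ | suc _ | inj₁ refl = refl
    ... | _ | _     | inj₂ refl = refl

    -- Here the junk value matters: `2F` decodes on the right to `suc j`, which is wrong for the
    -- excluded pair, so that case has to be refuted.
    decodeʳ-row : ∀ j → decodeʳ (row _*_ j) j ≡ suc j * zero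
    decodeʳ-row j with zero * suc j | suc j * zero | tv zero (suc j) | tv (suc j) zero
                     -- Abstracted together with the products, so that its two premises become
                     -- `refl` in the last case.
                     | excluded {j}
    ... | _ | _ | inj₁ refl | inj₁ refl | _  = refl
    ... | _ | _ | inj₁ refl | inj₂ refl | _  = refl
    ... | _ | _ | inj₂ refl | inj₁ refl | _  = refl
    ... | _ | _ | inj₂ refl | inj₂ refl | ¬p = ⊥-elim (¬p refl refl)

    extend-restrict : ∀ x y → extend (row _*_) (restrict _*_) x y ≡ x * y
    extend-restrict zero    zero    = sym zero*zero
    extend-restrict zero    (suc j) = decodeˡ-row j
    extend-restrict (suc i) zero    = decodeʳ-row i
    extend-restrict (suc i) (suc j) = suc-restrict i j

module _ (f : Fin n → Fin 3) {_*_ : Op₂ (Fin n)} where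

  extend-isTwoValue : IsTwoValue _*_ → IsTwoValue (extend f _*_)
  extend-isTwoValue tv zero    zero    = inj₁ refl
  extend-isTwoValue tv zero    (suc j) with f j
  ... | 0F = inj₁ refl
  ... | 1F = inj₁ refl
  ... | 2F = inj₂ refl
  extend-isTwoValue tv (suc i) zero    with f i
  ... | 0F = inj₂ refl
  ... | 1F = inj₁ refl
  ... | 2F = inj₁ refl
  extend-isTwoValue tv (suc i) (suc j) = Sum.map (cong suc) (cong suc) (tv i j)

  -- Under `0F` and `2F` both products of a new pair coincide, and a two-value operation fixes the
  -- diagonal. Under `1F` the operation is the left projection on the pair, so the same product is
  -- formed twice.
  extend-isIdempotent : IsTwoValue _*_ → IsIdempotent _*_ → IsIdempotent (extend f _*_)
  extend-isIdempotent tv idem zero    zero    = refl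
  extend-isIdempotent tv idem zero    (suc j) with f j in eq
  ... | 0F = refl
  -- The outer product is again that of `zero` and `suc j`; its reduction brings `f j` back, so `eq`
  -- is needed.
  ... | 1F = cong (λ c → decodeˡ c j) eq
  ... | 2F = cong suc (Sum.reduce (tv j j))
  extend-isIdempotent tv idem (suc i) zero    with f i in eq
  ... | 0F = refl
  ... | 1F = cong (λ c → decodeʳ c i) eq
  ... | 2F = cong suc (Sum.reduce (tv i i))
  extend-isIdempotent tv idem (suc i) (suc j) = cong suc (idem i j)

row-cong : {_∘_ _*_ : Op₂ (Fin (suc n))} → (∀ x y → x ∘ y ≡ x * y) → row _∘_ ≗ row _*_
row-cong p j = cong₂ encode (p zero (suc j)) (p (suc j) zero)

restrict-cong : {_∘_ _*_ : Op₂ (Fin (suc n))} → (∀ x y → x ∘ y ≡ x * y) →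
  ∀ i j → restrict _∘_ i j ≡ restrict _*_ i j
restrict-cong p i j = cong (predOr i) (p (suc i) (suc j))

extend-cong : {f g : Fin n → Fin 3} {_∘_ _*_ : Op₂ (Fin n)} → f ≗ g →
  (∀ i j → i ∘ j ≡ i * j) → ∀ x y → extend f _∘_ x y ≡ extend g _*_ x y
extend-cong p q zero    zero    = refl
extend-cong p q zero    (suc j) = cong (λ c → decodeˡ c j) (p j)
extend-cong p q (suc i) zero    = cong (λ c → decodeʳ c i) (p i)
extend-cong p q (suc i) (suc j) = cong suc (q i j)

row×restrict : Inverse (idempotentTwoValueMagmas (Fin (suc n)))
                       ((Fin n →-setoid Fin 3) ×ₛ idempotentTwoValueMagmas (Fin n))
row×restrict = record
  { to        = λ (_*_ , tv , idem) →
      row _*_ , restrict _*_ , restrict-isTwoValue tv , restrict-isIdempotent tv idem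
  ; from      = λ (f , _*_ , tv , idem) →
      extend f _*_ , extend-isTwoValue f tv , extend-isIdempotent f tv idem
  ; to-cong   = λ p → row-cong p , restrict-cong p
  ; from-cong = λ (p , q) → extend-cong p q
  ; inverse   =
      -- `restrict (extend f _*_)` computes to `_*_` pointwise, so only the row needs a correction.
      (λ {(f , _)} p → (λ j → trans (row-cong p j) (encode-decode (f j) j)) , restrict-cong p)
    , (λ {(_ , tv , idem)} (p , q) x y → trans (extend-cong p q x y) (extend-restrict tv idem x y))
  }

-- Counting

funToFin-cong : {f g : Fin m → Fin n} → f ≗ g → funToFin f ≡ funToFin g
funToFin-cong {m = zero}  p = refl
funToFin-cong {m = suc m} p = cong₂ combine (p zero) (funToFin-cong (p ∘ suc))

→-hasCardinality : ∀ m n → HasCardinality (Fin m →-setoid Fin n) (n ^ m)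
→-hasCardinality m n = record
  { to        = funToFin
  ; from      = finToFun
  ; to-cong   = funToFin-cong
  ; from-cong = λ { refl _ → refl }
  ; inverse   = (λ {k} p → trans (funToFin-cong p) (funToFin-finToFin {m} k))
              , (λ { {f} refl → finToFun-funToFin f })
  }

×-hasCardinality : ∀ {c d ℓ₁ ℓ₂} {S : Setoid c ℓ₁} {T : Setoid d ℓ₂} →
  HasCardinality S m → HasCardinality T n → HasCardinality (S ×ₛ T) (m * n)
×-hasCardinality p q =
  Inv.trans (p ×-inverse q) (Inv.trans Pointwise-≡↔≡ (Inv.sym *↔×))

-- Pascal's rule; the summand `n` counts the pairs that contain the added point.
[1+n]C2 : ∀ n → suc n C 2 ≡ n + n C 2
[1+n]C2 n = trans (sym (nCk+nC[k+1]≡[n+1]C[k+1] n 1)) (cong (_+ n C 2) (nC1≡n n))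

Fin-hasCardinality : ∀ n → HasCardinality (idempotentTwoValueMagmas (Fin n)) (3 ^ (n C 2))
-- The empty set carries one operation up to pointwise equality, and `3 ^ (0 C 2)` computes to `1`.
Fin-hasCardinality zero    = record
  { to        = λ _ → zero
  ; from      = λ _ → (λ ()) , (λ ()) , λ ()
  ; to-cong   = λ _ → refl
  ; from-cong = λ _ ()
  ; inverse   = (λ { {zero} _ → refl }) , λ _ ()
  }
Fin-hasCardinality (suc n) =
  subst (HasCardinality _)
    (sym (trans (cong (3 ^_) ([1+n]C2 n)) (^-distribˡ-+-* 3 n (n C 2))))
    (Inv.trans row×restrict (×-hasCardinality (→-hasCardinality n 3) (Fin-hasCardinality n)))

proposition26 : ∀ {a} (X : Set a) (n : ℕ) → HasCardinality (setoid X) n →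
    let N = n C 2
        S = ∑[ m ≤ N ] ((N C toℕ m) * 2 ^ (N ∸ toℕ m))
    in HasCardinality (idempotentTwoValueMagmas X) S × S ≡ 3 ^ N
proposition26 X n X↔n =
    -- The magmas are counted directly as `3 ^ N`; the sum enters only through its equality with
    -- this power.
    subst (HasCardinality _) (sym S≡3^N)
      (Inv.trans (idempotentTwoValueMagmas-cong X↔n) (Fin-hasCardinality n))
  , S≡3^N
  where S≡3^N = ∑C*2^≡3^ (n C 2)
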